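{- Every Hamiltonian $4$-leaf power is cycle extendable.
   Context: All graphs are finite, undirected, and simple. A graph is Hamiltonian if it has a cycle through all its vertices. A graph $G$ is a $k$-leaf power if there exists a tree $T$ such that (1) the vertices of $G$ one-to-one correspond to the leaves of $T$, and (2) for every two vertices $u,v\in V(G)$, $uv\in E(G)$ if and only if the distance between $u$ and $v$ in $T$ is at most $k$. A cycle $C$ in a graph is extendable if there exists a cycle $C'$ whose vertex set consists of all vertices of $C$ plus exactly one more vertex not in $C$. A graph is cycle extendable if all its non-Hamiltonian cycles are extendable. -}

module Defs where

open import Data.Nat.Base using (ℕ; zero; suc; _≤_; NonZero)
open import Data.Fin.Base using (Fin)
open import Data.List.Base using (List; []; _∷_; _∷ʳ_; length; filter; allFin)
open import Data.List.Membership.Propositional using (_∈_; _∉_)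
open import Data.List.Relation.Unary.Linked using (Linked)
open import Data.List.Relation.Unary.Unique.Propositional using (Unique)
open import Data.Product.Base using (Σ-syntax; ∃-syntax; _×_; proj₁)
open import Data.Sum.Base using (_⊎_)
open import Function.Bundles using (_⇔_; _⤖_; module Bijection)
open import Level using (0ℓ)
open import Relation.Binary.Core using (Rel)
open import Relation.Binary.Definitions using (Symmetric; Irreflexive; Decidable)
open import Relation.Binary.PropositionalEquality.Core using (_≡_; _≢_)
open import Relation.Nullary.Negation.Core using (¬_)

-- Decidability of adjacency is part of the data: classically it is automatic,
-- constructively it is what makes the graph a finite object.
record Graph (n : ℕ) : Set₁ where
  field
    Adj    : Rel (Fin n) 0ℓ
    adj?   : Decidable Adj
    sym    : Symmetric Adj
    irrefl : Irreflexive _≡_ Adj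

module _ {n : ℕ} (G : Graph n) where

  open Graph G

  degree : Fin n → ℕ
  degree v = length (filter (adj? v) (allFin n))

  data Walk : Fin n → Fin n → ℕ → Set where
    []  : ∀ {u} → Walk u u zero
    _∷_ : ∀ {u v w d} → Adj u v → Walk v w d → Walk u w (suc d)

  IsDistance : Fin n → Fin n → ℕ → Set
  IsDistance u v d = Walk u v d × (∀ e → Walk u v e → d ≤ e)

  DistanceAtMost : ℕ → Fin n → Fin n → Set
  DistanceAtMost k u v = ∃[ d ] (IsDistance u v d × d ≤ k)

  -- A cycle is given by its distinct vertices in cyclic order, from an
  -- arbitrary starting vertex; repeating `start` at the end of the list in
  -- `linked` accounts for the closing edge.
  record Cycle : Set where
    field
      start : Fin n
      rest  : List (Fin n)

    vertices : List (Fin n)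
    vertices = start ∷ rest

    field
      length≥3 : 3 ≤ length vertices
      unique   : Unique vertices
      linked   : Linked Adj (vertices ∷ʳ start)

  open Cycle using (vertices)

  IsHamiltonianCycle : Cycle → Set
  IsHamiltonianCycle C = ∀ v → v ∈ vertices C

  Hamiltonian : Set
  Hamiltonian = ∃[ C ] IsHamiltonianCycle C

  Extendable : Cycle → Set
  Extendable C =
    Σ[ C′ ∈ Cycle ] ∃[ v ]
      (v ∉ vertices C × (∀ w → w ∈ vertices C′ ⇔ (w ∈ vertices C ⊎ w ≡ v)))

  CycleExtendable : Set
  CycleExtendable = ∀ C → ¬ IsHamiltonianCycle C → Extendable C

  record IsTree : Set where
    field
      nonEmpty  : NonZero n
      connected : ∀ u v → ∃[ d ] Walk u v d
      acyclic   : ¬ Cycle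

  Leaf : Set
  Leaf = ∃[ x ] degree x ≡ 1

record IsLeafPower (k : ℕ) {n : ℕ} (G : Graph n) : Set₁ where
  field
    {size} : ℕ
    T      : Graph size
    isTree : IsTree T
    leaves : Fin n ⤖ Leaf T

  leaf : Fin n → Fin size
  leaf v = proj₁ (Bijection.to leaves v)

  field
    adj⇔close : ∀ u v → u ≢ v →
                Graph.Adj G u v ⇔ DistanceAtMost T k (leaf u) (leaf v)

{-# OPTIONS --safe #-}

-- Send each vertex of G to the neighbour in T of its leaf: two distinct
-- vertices of G are adjacent iff their images lie in a common closed star of T.
-- Root T at the image of a vertex c of the cycle C, and let H be a cycle whose
-- vertex set properly contains that of C, initially a Hamiltonian one.  Let v be
-- a deepest vertex of H outside C, and x its image.  If C visits a vertex
-- strictly below x, then some edge of C enters the part of T below x; x shares a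
-- closed star with both its ends, so v can be inserted into that edge.
-- Otherwise H visits nothing strictly below x, so the neighbours of v on H all
-- lie in the closed star of the parent of x, and H can bypass v.  Bypassing goes
-- on until only one vertex of H lies outside C.

module Submission where

open import Defs
open import Data.Empty using (⊥-elim)
open import Data.Fin.Base using (Fin)
open import Data.Fin.Properties using (_≟_; any?)
open import Data.List.Base using (List; []; _∷_; _∷ʳ_; _++_; length; filter; allFin)
open import Data.List.Membership.Propositional using (_∈_; _∉_)
open import Data.List.Membership.Propositional.Properties
  using (∈-∃++; ∈-filter⁺; ∈-filter⁻; ∈-allFin)
open import Data.List.Properties using (++-assoc; ++-identityʳ)
open import Data.List.Relation.Binary.Permutation.Propositional
  using (_↭_; refl; prep; swap; ↭-sym; ↭-trans; ↭⇒↭ₛ)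
open import Data.List.Relation.Binary.Permutation.Propositional.Properties
  using (All-resp-↭; ∈-resp-↭; ↭-length; shift; drop-∷; ∷↭∷ʳ)
  renaming (++-comm to ↭-++-comm; ++⁺ʳ to ↭-++⁺ʳ)
import Data.List.Relation.Binary.Permutation.Setoid.Properties as Permutationₛ
open import Data.List.Relation.Unary.All as All using (All; []; _∷_)
import Data.List.Relation.Unary.All.Properties as All
open import Data.List.Relation.Unary.AllPairs using ([]; _∷_)
open import Data.List.Relation.Unary.Any as Any using (Any; here; there)
open import Data.List.Relation.Unary.Linked as Linked using (Linked; []; [-]; _∷_)
open import Data.List.Relation.Unary.Linked.Properties using (AllPairs⇒Linked)
open import Data.List.Relation.Unary.Unique.Propositional using (Unique)
open import Data.Nat.Base using (ℕ; zero; suc; _+_; _≤_; _<_; z≤n; s≤s)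
open import Data.Nat.Induction using (<-wellFounded; Acc; acc)
open import Data.Nat.Properties
  using (≤-refl; ≤-trans; ≤-reflexive; ≤-total; ≤-antisym; <⇒≤; <⇒≢; <⇒≱; ≮⇒≥; <-trans;
         <-≤-trans; m≤n⇒m≤1+n; m≤n⇒m<n∨m≡n; n<1+n; suc-injective; ≡-irrelevant;
         +-mono-≤; anyUpTo?)
open import Data.Product.Base using (∃-syntax; _×_; _,_; proj₁; proj₂)
open import Data.Sum.Base using (_⊎_; inj₁; inj₂)
open import Function.Base using (_∘_)
open import Function.Bundles using (module Bijection; module Equivalence; mk⇔)
open import Level using (0ℓ)
open import Relation.Binary.Core using (Rel)
open import Relation.Binary.PropositionalEquality
  using (_≡_; _≢_; refl; sym; cong; subst; subst₂; setoid) renaming (trans to ≡-trans)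
open import Relation.Nullary.Decidable using (Dec; yes; no; map′; _×-dec_; _⊎-dec_)
open import Relation.Nullary.Negation using (¬_; contradiction)
open import Relation.Unary using (Pred; Decidable)

-- Lists up to permutation, and linked lists read as closed sequences.

module _ {A : Set} where

  Unique-resp-↭ : {xs ys : List A} → xs ↭ ys → Unique xs → Unique ys
  Unique-resp-↭ p = Permutationₛ.Unique-resp-↭ (setoid A) (↭⇒↭ₛ p)

  -- Applied to the vertex lists of two cycles, `zs` collects the vertices of the larger one outside
  -- the smaller.
  unique-⊆⇒↭++ : {xs ys : List A} → Unique xs → (∀ {x} → x ∈ xs → x ∈ ys) →
                 ∃[ zs ] ys ↭ zs ++ xs
  unique-⊆⇒↭++ {[]} {ys} _ _ = ys , subst (ys ↭_) (sym (++-identityʳ ys)) refl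
  unique-⊆⇒↭++ {x ∷ xs} {ys} (x∉xs ∷ uxs) xs⊆ys with ∈-∃++ (xs⊆ys (here refl))
  ... | us , ws , refl with unique-⊆⇒↭++ uxs xs⊆rest
    where
    xs⊆rest : ∀ {y} → y ∈ xs → y ∈ us ++ ws
    xs⊆rest y∈xs with ∈-resp-↭ (shift x us ws) (xs⊆ys (there y∈xs))
    ... | here refl = contradiction refl (All.lookup x∉xs y∈xs)
    ... | there y∈  = y∈
  ... | zs , p = zs , ↭-trans (shift x us ws) (↭-trans (prep x p) (↭-sym (shift x zs xs)))

  unique-++⇒∉ : ∀ xs {ys : List A} → Unique (xs ++ ys) → All (_∉ ys) xs
  unique-++⇒∉ []       _          = []
  unique-++⇒∉ (x ∷ xs) (x∉ ∷ u) = All.All¬⇒¬Any (All.++⁻ʳ xs x∉) ∷ unique-++⇒∉ xs u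

  maximum : (f : A → ℕ) (x : A) (xs : List A) →
            ∃[ v ] ∃[ ys ] (x ∷ xs ↭ v ∷ ys) × All (λ y → f y ≤ f v) ys
  maximum f x []       = x , [] , refl , []
  maximum f x (y ∷ xs) with maximum f y xs
  ... | v , ys , p , ys≤v with ≤-total (f x) (f v)
  ...   | inj₁ x≤v = v , x ∷ ys , ↭-trans (prep x p) (swap x v refl) , x≤v ∷ ys≤v
  ...   | inj₂ v≤x = x , v ∷ ys , prep x p , v≤x ∷ All.map (λ y≤v → ≤-trans y≤v v≤x) ys≤v

  -- After its first entry the closed list is a rotation of `c ∷ y ∷ ys`, hence unique; `y` keeps
  -- the two copies of `c` apart.
  linked-≢ : ∀ {c y ys} → Unique (c ∷ y ∷ ys) → Linked _≢_ (c ∷ (y ∷ ys) ∷ʳ c)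
  linked-≢ {c} {y} {ys} u@((c≢y ∷ _) ∷ _) =
    c≢y ∷ AllPairs⇒Linked (Unique-resp-↭ (∷↭∷ʳ c (y ∷ ys)) u)

  module _ {R : Rel A 0ℓ} where

    linked-++⁻ : ∀ xs {y ys} → Linked R (xs ++ y ∷ ys) → Linked R (xs ∷ʳ y) × Linked R (y ∷ ys)
    linked-++⁻ []            l       = [-] , l
    linked-++⁻ (x ∷ [])      (e ∷ l) = e ∷ [-] , l
    linked-++⁻ (x ∷ u ∷ xs)  (e ∷ l) with linked-++⁻ (u ∷ xs) l
    ... | l₁ , l₂ = e ∷ l₁ , l₂

    linked-++⁺ : ∀ xs {y ys} → Linked R (xs ∷ʳ y) → Linked R (y ∷ ys) → Linked R (xs ++ y ∷ ys)
    linked-++⁺ []           _        m = m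
    linked-++⁺ (x ∷ [])     (e ∷ _)  m = e ∷ m
    linked-++⁺ (x ∷ u ∷ xs) (e ∷ l)  m = e ∷ linked-++⁺ (u ∷ xs) l m

    linked-∷ʳ : ∀ xs {y z} → Linked R (xs ∷ʳ y) → R y z → Linked R (xs ∷ʳ y ∷ʳ z)
    linked-∷ʳ xs {y} {z} l e =
      subst (Linked R) (sym (++-assoc xs (y ∷ []) (z ∷ []))) (linked-++⁺ xs l (e ∷ [-]))

    -- Cut the closed sequence at `c` into two arcs, swap them and glue them at `h`.
    rotate : ∀ h us c ws → Linked R (h ∷ (us ++ c ∷ ws) ∷ʳ h) →
             Linked R (c ∷ (ws ++ h ∷ us) ∷ʳ c)
    rotate h us c ws l
      with linked-++⁻ (h ∷ us) (subst (λ xs → Linked R (h ∷ xs)) (++-assoc us (c ∷ ws) (h ∷ [])) l)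
    ... | l₁ , l₂ = subst (λ xs → Linked R (c ∷ xs)) (sym (++-assoc ws (h ∷ us) (c ∷ [])))
                          (linked-++⁺ (c ∷ ws) l₂ l₁)

    rebase : ∀ {h hs c} → c ∈ h ∷ hs → Linked R (h ∷ hs ∷ʳ h) →
             ∃[ ys ] (h ∷ hs ↭ c ∷ ys) × Linked R (c ∷ ys ∷ʳ c)
    rebase {h} {hs} {c} (here refl) l = hs , refl , l
    rebase {h} {c = c} (there c∈hs) l with ∈-∃++ c∈hs
    ... | us , ws , refl = ws ++ h ∷ us , ↭-++-comm (h ∷ us) (c ∷ ws) , rotate h us c ws l

    -- The list starts outside `P` and meets `P` later, so some link crosses into `P`; `v` is put
    -- into the first such link.
    linked-insert : {P : Pred A 0ℓ} → Decidable P → ∀ {v} →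
                    (∀ {s t} → ¬ P s → P t → R s t → R s v × R v t) →
                    ∀ {y z} ys → ¬ P y → Any P ys → Linked R (y ∷ ys ∷ʳ z) →
                    ∃[ ys′ ] (ys′ ↭ v ∷ ys) × Linked R (y ∷ ys′ ∷ʳ z)
    linked-insert P? {v} enter (w ∷ ws) ¬Py any (e ∷ l) with P? w
    ... | yes Pw with enter ¬Py Pw e
    ...   | e₁ , e₂ = v ∷ w ∷ ws , refl , e₁ ∷ e₂ ∷ l
    linked-insert P? enter (w ∷ ws) ¬Py (here Pw)   (e ∷ l) | no ¬Pw = contradiction Pw ¬Pw
    linked-insert P? {v} enter (w ∷ ws) ¬Py (there any) (e ∷ l) | no ¬Pw
      with linked-insert P? enter ws ¬Pw any l
    ... | ys′ , p , l′ = w ∷ ys′ , ↭-trans (prep w p) (swap w v refl) , e ∷ l′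

    linked-delete : {P : Pred A 0ℓ} → ∀ {v} →
                    (∀ {a b} → P a → P b → R a v → R v b → R a b) →
                    ∀ x us zs → All P (x ∷ us) → All P zs →
                    Linked R (x ∷ us ++ v ∷ zs) → Linked R (x ∷ us ++ zs)
    linked-delete skip x []       []       _          _        _           = [-]
    linked-delete skip x []       (z ∷ zs) (Px ∷ _)   (Pz ∷ _) (e ∷ f ∷ l) = skip Px Pz e f ∷ l
    linked-delete skip x (u ∷ us) zs       (_ ∷ Pus)  Pzs      (e ∷ l)     =
      e ∷ linked-delete skip u us zs Pus Pzs l

-- Walks, distances and closed stars.

module _ {N : ℕ} (T : Graph N) where

  open Graph T using (Adj; adj?)

  walk? : ∀ u v d → Dec (Walk T u v d)
  walk? u v zero    = map′ (λ { refl → [] }) (λ { [] → refl }) (u ≟ v)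
  walk? u v (suc d) = map′ (λ (_ , e , p) → e ∷ p) (λ { (e ∷ p) → _ , e , p })
                           (any? λ w → adj? u w ×-dec walk? w v d)

  -- Well-founded descent on the length: since walks of a given length are decidable, either no
  -- shorter walk exists or one is found and the search continues from it.
  walk⇒distanceAtMost : ∀ {u v d} → Walk T u v d → DistanceAtMost T d u v
  walk⇒distanceAtMost {u} {v} = shortest (<-wellFounded _)
    where
    shortest : ∀ {d} → Acc _<_ d → Walk T u v d → DistanceAtMost T d u v
    shortest {d} (acc rs) p with anyUpTo? (walk? u v) d
    ... | no ∄shorter = d , (p , λ e q → ≮⇒≥ λ e<d → ∄shorter (e , e<d , q)) , ≤-refl
    ... | yes (e , e<d , q) with shortest (rs e<d) q
    ...   | f , dist , f≤e = f , dist , ≤-trans f≤e (<⇒≤ e<d)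

  degree1⇒neighbour : ∀ {v} → degree T v ≡ 1 → ∃[ q ] Adj v q × (∀ {w} → Adj v w → w ≡ q)
  degree1⇒neighbour {v} deg≡1 =
    singleton (filter (adj? v) (allFin N)) deg≡1
      (λ q∈ → proj₂ (∈-filter⁻ (adj? v) {xs = allFin N} q∈))
      (λ e → ∈-filter⁺ (adj? v) (∈-allFin _) e)
    where
    singleton : ∀ xs → length xs ≡ 1 → (∀ {q} → q ∈ xs → Adj v q) → (∀ {q} → Adj v q → q ∈ xs) →
                ∃[ q ] Adj v q × (∀ {w} → Adj v w → w ≡ q)
    singleton (q ∷ []) _ sound complete = q , sound (here refl) , λ e → only (complete e)
      where
      only : ∀ {w} → w ∈ q ∷ [] → w ≡ q
      only (here eq) = eq

  Star : Fin N → Fin N → Set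
  Star m z = z ≡ m ⊎ Adj z m

  -- Distance at most two, in a form that names a centre.
  CoStellar : Rel (Fin N) 0ℓ
  CoStellar y z = ∃[ m ] Star m y × Star m z

-- Trees rooted at `r`: depth, parents, descendants.

module Rooted {N : ℕ} (T : Graph N) (tree : IsTree T) (r : Fin N) where

  open Graph T renaming (sym to adj-sym)
  open IsTree tree

  distance-to-root : ∀ u → ∃[ d ] IsDistance T u r d
  distance-to-root u with connected u r
  ... | _ , p with walk⇒distanceAtMost T p
  ...   | d , dist , _ = d , dist

  depth : Fin N → ℕ
  depth u = proj₁ (distance-to-root u)

  depth-walk : ∀ u → Walk T u r (depth u)
  depth-walk u = proj₁ (proj₂ (distance-to-root u))

  depth-minimal : ∀ {u e} → Walk T u r e → depth u ≤ e
  depth-minimal {u} p = proj₂ (proj₂ (distance-to-root u)) _ p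

  depth≡0⇒root : ∀ {u} → depth u ≡ 0 → u ≡ r
  depth≡0⇒root {u} eq with depth u | depth-walk u
  depth≡0⇒root refl | zero | [] = refl

  adj⇒depth≤ : ∀ {u w} → Adj u w → depth u ≤ suc (depth w)
  adj⇒depth≤ {w = w} e = depth-minimal (e ∷ depth-walk w)

  infix 4 _◁_

  -- The parent relation, with the parent on the left.
  _◁_ : Rel (Fin N) 0ℓ
  y ◁ z = Adj y z × depth z ≡ suc (depth y)

  -- Take the second vertex of a shortest walk to the root: the edge bounds its depth from below,
  -- the remaining walk from above.
  parent : ∀ {u k} → depth u ≡ suc k → ∃[ w ] w ◁ u
  parent {u} eq with depth u in eq′ | depth-walk u
  parent refl | suc k | _∷_ {v = w} e p =
    w , adj-sym e ,
    ≤-antisym (≤-trans (≤-reflexive (sym eq′)) (adj⇒depth≤ e)) (s≤s (depth-minimal p))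

  -- Depth alone separates the two ends from the interior.
  unique-between : ∀ {k u u′ xs} → depth u ≡ k → depth u′ ≡ k → u ≢ u′ →
                   Unique xs → All (λ x → depth x < k) xs → Unique (u ∷ xs ∷ʳ u′)
  unique-between {k} {u} {u′} {xs} du du′ u≢u′ uxs xs<k =
    Unique-resp-↭ (prep u (∷↭∷ʳ u′ xs))
      ((u≢u′ ∷ avoids du) ∷ avoids du′ ∷ uxs)
    where
    avoids : ∀ {z} → depth z ≡ k → All (z ≢_) xs
    avoids dz = All.map (λ { x<k refl → <⇒≢ x<k dz }) xs<k

  -- Climb from both ends towards the root until the two branches meet.
  arch : ∀ k {u u′} → depth u ≡ k → depth u′ ≡ k → u ≢ u′ →
         ∃[ x ] ∃[ xs ] Linked Adj (u ∷ (x ∷ xs) ∷ʳ u′) × Unique (x ∷ xs) ×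
                        All (λ z → depth z < k) (x ∷ xs)
  arch zero    du du′ u≢u′ = contradiction (≡-trans (depth≡0⇒root du) (sym (depth≡0⇒root du′))) u≢u′
  arch (suc k) du du′ u≢u′ with parent du | parent du′
  ... | y , e , dy | y′ , e′ , dy′ with y ≟ y′
  ...   | yes refl = y , [] , adj-sym e ∷ e′ ∷ [-] , [] ∷ [] , ≤-reflexive (≡-trans (sym dy) du) ∷ []
  ...   | no y≢y′ with arch k (suc-injective (≡-trans (sym dy) du))
                              (suc-injective (≡-trans (sym dy′) du′)) y≢y′
  ...     | x , xs , l , uxs , xs<k =
    y , (x ∷ xs) ∷ʳ y′ ,
    adj-sym e ∷ linked-∷ʳ (y ∷ x ∷ xs) l e′ ,
    unique-between (suc-injective (≡-trans (sym dy) du))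
                   (suc-injective (≡-trans (sym dy′) du′)) y≢y′ uxs xs<k ,
    ≤-reflexive (≡-trans (sym dy) du) ∷
      All.++⁺ (All.map m≤n⇒m≤1+n xs<k) (≤-reflexive (≡-trans (sym dy′) du′) ∷ [])

  -- An edge between two vertices of equal depth would close the arch joining them into a cycle.
  adj⇒depth≢ : ∀ {u w} → Adj u w → depth u ≢ depth w
  adj⇒depth≢ {u} {w} e du≡dw with arch (depth w) du≡dw refl (λ { refl → irrefl refl e })
  ... | x , xs , l , uxs , xs<k = acyclic record
    { start    = u
    ; rest     = (x ∷ xs) ∷ʳ w
    -- Moving `w` to the front of the list exposes the three entries to be counted.
    ; length≥3 = subst (3 ≤_) (cong suc (↭-length (∷↭∷ʳ w (x ∷ xs)))) (s≤s (s≤s (s≤s z≤n)))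
    ; unique   = unique-between du≡dw refl (λ { refl → irrefl refl e }) uxs xs<k
    ; linked   = linked-∷ʳ (u ∷ x ∷ xs) l (adj-sym e)
    }

  -- Two distinct parents have equal depth, so an arch joins them through smaller depths, and `w`
  -- would close it into a cycle.
  parent-unique : ∀ {u u′ w} → u ◁ w → u′ ◁ w → u ≡ u′
  parent-unique {u} {u′} {w} (e , dw) (e′ , dw′) with u ≟ u′
  ... | yes u≡u′ = u≡u′
  ... | no  u≢u′ with arch (depth u′) (suc-injective (≡-trans (sym dw) dw′)) refl u≢u′
  ...   | x , xs , l , uxs , xs<k = ⊥-elim (acyclic record
    { start    = w
    ; rest     = u ∷ (x ∷ xs) ∷ʳ u′
    ; length≥3 = s≤s (s≤s (s≤s z≤n))
    ; unique   = All.map (λ { z<w refl → <⇒≢ z<w refl }) below-w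
                 ∷ unique-between du refl u≢u′ uxs xs<k
    ; linked   = adj-sym e ∷ linked-∷ʳ (u ∷ x ∷ xs) l e′
    })
    where
    du = suc-injective (≡-trans (sym dw) dw′)
    below-w : All (λ z → depth z < depth w) (u ∷ (x ∷ xs) ∷ʳ u′)
    below-w = ≤-reflexive (sym dw) ∷
      All.++⁺ (All.map (λ z<k → <-≤-trans z<k (≤-trans (<⇒≤ (n<1+n _)) (≤-reflexive (sym dw′)))) xs<k)
              (≤-reflexive (sym dw′) ∷ [])

  orient : ∀ {u w} → Adj u w → u ◁ w ⊎ w ◁ u
  orient e with m≤n⇒m<n∨m≡n (adj⇒depth≤ e) | m≤n⇒m<n∨m≡n (adj⇒depth≤ (adj-sym e))
  ... | inj₂ eq      | _            = inj₂ (adj-sym e , eq)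
  ... | inj₁ _       | inj₂ eq      = inj₁ (e , eq)
  ... | inj₁ (s≤s p) | inj₁ (s≤s q) = contradiction (≤-antisym p q) (adj⇒depth≢ e)

  data Below (x : Fin N) : Fin N → Set where
    child : ∀ {z} → x ◁ z → Below x z
    below : ∀ {y z} → Below x y → y ◁ z → Below x z

  Below⇒depth< : ∀ {x z} → Below x z → depth x < depth z
  Below⇒depth< (child (_ , eq))   = ≤-reflexive (sym eq)
  Below⇒depth< (below b (_ , eq)) = <-trans (Below⇒depth< b) (≤-reflexive (sym eq))

  -- Parents are unique, so the question for `z` reduces to the parent of `z`; a vertex of depth
  -- zero lies below nothing.
  below? : ∀ x z → Dec (Below x z)
  below? x z = go (depth z) z refl
    where
    go : ∀ k z → depth z ≡ k → Dec (Below x z)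
    go zero    z dz = no λ b → contradiction (subst (depth x <_) dz (Below⇒depth< b)) λ ()
    go (suc k) z dz with parent dz
    ... | y , y◁z =
      map′ (λ { (inj₁ refl) → child y◁z ; (inj₂ b) → below b y◁z })
           (λ { (child x◁z)     → inj₁ (parent-unique x◁z y◁z)
              ; (below b y′◁z) → inj₂ (subst (Below x) (parent-unique y′◁z y◁z) b) })
           ((x ≟ y) ⊎-dec go k y (suc-injective (≡-trans (sym (proj₂ y◁z)) dz)))

  ¬Below-root : ∀ {x} → ¬ Below x r
  ¬Below-root b = contradiction (<-≤-trans (Below⇒depth< b) (depth-minimal [])) λ ()

  parent-below : ∀ {x y z} → Below x z → y ◁ z → y ≡ x ⊎ Below x y
  parent-below (child x◁z)    y◁z = inj₁ (parent-unique y◁z x◁z)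
  parent-below (below b y′◁z) y◁z = inj₂ (subst (Below _) (parent-unique y′◁z y◁z) b)

  -- Closed stars relative to a vertex and its descendants.

  -- The closed star of the parent of `x`; the case `z ≡ x` covers the root, which has no parent.
  NearParent : Fin N → Fin N → Set
  NearParent x z = z ≡ x ⊎ ∃[ q ] (q ◁ x × Star T q z)

  -- Follow at most two edges from `x`. If the first goes up, the end lies in the star of the
  -- parent; if it goes down, the second either returns to `x` or goes further down.
  costellar⇒below⊎near : ∀ {x z} → CoStellar T x z → Below x z ⊎ NearParent x z
  costellar⇒below⊎near (_ , inj₁ refl , inj₁ z≡x) = inj₂ (inj₁ z≡x)
  costellar⇒below⊎near (_ , inj₁ refl , inj₂ e) with orient e
  ... | inj₁ z◁x = inj₂ (inj₂ (_ , z◁x , inj₁ refl))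
  ... | inj₂ x◁z = inj₁ (child x◁z)
  costellar⇒below⊎near (m , inj₂ e , st) with orient e
  ... | inj₂ m◁x = inj₂ (inj₂ (m , m◁x , st))
  costellar⇒below⊎near (m , inj₂ e , inj₁ refl) | inj₁ x◁m = inj₁ (child x◁m)
  costellar⇒below⊎near (m , inj₂ e , inj₂ e′) | inj₁ x◁m with orient e′
  ... | inj₁ z◁m = inj₂ (inj₁ (parent-unique z◁m x◁m))
  ... | inj₂ m◁z = inj₁ (below (child x◁m) m◁z)

  near⇒costellar : ∀ {x a b} → NearParent x a → NearParent x b → CoStellar T a b
  near⇒costellar (inj₁ refl) (inj₁ refl) = _ , inj₁ refl , inj₁ refl
  near⇒costellar (inj₁ refl) (inj₂ (q , q◁x , b)) = q , inj₂ (adj-sym (proj₁ q◁x)) , b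
  near⇒costellar (inj₂ (q , q◁x , a)) (inj₁ refl) = q , a , inj₂ (adj-sym (proj₁ q◁x))
  near⇒costellar (inj₂ (q , q◁x , a)) (inj₂ (q′ , q′◁x , b)) with parent-unique q◁x q′◁x
  ... | refl = q , a , b

  bypass : ∀ {x a b} → ¬ Below x a → ¬ Below x b → CoStellar T a x → CoStellar T x b →
           CoStellar T a b
  bypass ¬ba ¬bb (m , a , x) xb with costellar⇒below⊎near (m , x , a) | costellar⇒below⊎near xb
  ... | inj₁ ba | _       = contradiction ba ¬ba
  ... | inj₂ _  | inj₁ bb = contradiction bb ¬bb
  ... | inj₂ na | inj₂ nb = near⇒costellar na nb

  -- The part below `x` can be entered only through `x`, so `x` is `s` or `m`. Either way `x` lies
  -- in the star of `m`, and `m` is a centre for both new pairs.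
  enter-below : ∀ {x s t} → ¬ Below x s → Below x t → CoStellar T s t →
                CoStellar T s x × CoStellar T x t
  enter-below {x} ¬bs bt (m , s , t) = (m , s , star-x s t) , (m , star-x s t , t)
    where
    leave : ∀ {s} → Below x m → Star T m s → ¬ Below x s → Star T m x
    leave bm (inj₁ refl) ¬bs = contradiction bm ¬bs
    leave bm (inj₂ e)    ¬bs with orient e
    ... | inj₂ m◁s = contradiction (below bm m◁s) ¬bs
    ... | inj₁ s◁m with parent-below bm s◁m
    ...   | inj₁ refl = inj₂ e
    ...   | inj₂ bs   = contradiction bs ¬bs
    star-x : Star T m _ → Star T m _ → Star T m x
    star-x s (inj₁ refl) = leave bt s ¬bs
    star-x s (inj₂ e) with orient e
    ... | inj₁ t◁m = leave (below bt t◁m) s ¬bs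
    ... | inj₂ m◁t with parent-below bt m◁t
    ...   | inj₁ m≡x = inj₁ (sym m≡x)
    ...   | inj₂ bm  = leave bm s ¬bs

-- Extending a cycle of `G`, with the tree rooted at the image of its start.

module _ {n N : ℕ} (G : Graph n) (T : Graph N) (tree : IsTree T) (host : Fin n → Fin N)
         (adj⇒costellar : ∀ {u v} → Graph.Adj G u v → CoStellar T (host u) (host v))
         (costellar⇒adj : ∀ {u v} → u ≢ v → CoStellar T (host u) (host v) → Graph.Adj G u v)
  where

  -- Reflexive, so that vertices can be bypassed without checking that their
  -- neighbours on the cycle differ.
  Close : Rel (Fin n) 0ℓ
  Close u v = CoStellar T (host u) (host v)

  module _ (C : Cycle G) where

    open Cycle C renaming (start to c)
    open Rooted T tree (host c)

    -- Neighbours on the new closed list are distinct, which turns closeness back into adjacency.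
    extension : ∀ {v ys} → v ∉ vertices → ys ↭ v ∷ rest → Linked Close (c ∷ ys ∷ʳ c) →
                Extendable G C
    extension {v} {[]}     v∉C p l with () ← ↭-length p
    extension {v} {y ∷ ys} v∉C p l =
      C′ , v , v∉C , λ w → mk⇔ (λ w∈C′ → to (∈-resp-↭ q w∈C′)) (λ w∈ → ∈-resp-↭ (↭-sym q) (from w∈))
      where
      q : c ∷ y ∷ ys ↭ v ∷ vertices
      q = ↭-trans (prep c p) (swap c v refl)
      u : Unique (c ∷ y ∷ ys)
      u = Unique-resp-↭ (↭-sym q) (All.¬Any⇒All¬ vertices v∉C ∷ unique)
      C′ : Cycle G
      C′ = record
        { start    = c
        ; rest     = y ∷ ys
        ; length≥3 = ≤-trans length≥3 (≤-trans (<⇒≤ (n<1+n _)) (≤-reflexive (sym (↭-length q))))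
        ; unique   = u
        ; linked   = Linked.zipWith (λ (a≢b , ab) → costellar⇒adj a≢b ab) (linked-≢ u , l)
        }
      to : ∀ {w} → w ∈ v ∷ vertices → w ∈ vertices ⊎ w ≡ v
      to (here w≡v)  = inj₂ w≡v
      to (there w∈C) = inj₁ w∈C
      from : ∀ {w} → w ∈ vertices ⊎ w ≡ v → w ∈ v ∷ vertices
      from (inj₁ w∈C) = there w∈C
      from (inj₂ w≡v) = here w≡v

    -- Here `c ∷ ys` is the current larger cycle and `zs` its vertices outside `C`. The recursion,
    -- mutual with `bypass-deepest`, removes one of them per round.
    extendable-within : ∀ k {zs ys} → length zs ≡ suc k → All (_∉ vertices) zs → ys ↭ zs ++ rest →
                        Linked Close (c ∷ ys ∷ʳ c) → Extendable G C

    bypass-deepest : ∀ k {v zs ys} → length zs ≡ k → All (_∉ vertices) (v ∷ zs) →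
                     All (λ z → depth (host z) ≤ depth (host v)) zs → ys ↭ v ∷ zs ++ rest →
                     Linked Close (c ∷ ys ∷ʳ c) → Extendable G C

    extendable-within k {z ∷ zs} len zs∉C p l with maximum (depth ∘ host) z zs
    ... | v , zs′ , zs↭ , zs′≤v =
      bypass-deepest k (suc-injective (≡-trans (sym (↭-length zs↭)) len))
        (All-resp-↭ zs↭ zs∉C) zs′≤v (↭-trans p (↭-++⁺ʳ rest zs↭)) l

    bypass-deepest zero    {zs = []} _ (v∉C ∷ _) _ p l = extension v∉C p l
    bypass-deepest (suc k) {v} {zs} len (v∉C ∷ zs∉C) zs≤v p l
      with Any.any? (λ a → below? (host v) (host a)) rest
    -- The insertion is made in `C` itself, read from `c`, whose image is the root and so lies below
    -- nothing.
    ... | yes someBelow with linked-insert (λ a → below? (host v) (host a)) enter-below rest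
                               ¬Below-root someBelow (Linked.map adj⇒costellar linked)
    ...   | ys′ , p′ , l′ = extension v∉C p′ l′
    bypass-deepest (suc k) {v} {zs} len (v∉C ∷ zs∉C) zs≤v p l | no noneBelow
      with ∈-∃++ (∈-resp-↭ (↭-sym p) (here refl))
    ... | us , ws , refl = extendable-within k len zs∉C us++ws↭
      (subst (Linked Close ∘ (c ∷_)) (sym (++-assoc us ws (c ∷ [])))
        -- The closing `c` is part of the tail, so `v` has a successor even when it comes last.
        (linked-delete bypass c us (ws ∷ʳ c) (¬Below-root ∷ All.++⁻ˡ us ¬below)
          (All.++⁺ (All.++⁻ʳ us ¬below) (¬Below-root ∷ []))
          (subst (Linked Close ∘ (c ∷_)) (++-assoc us (v ∷ ws) (c ∷ [])) l)))
      where
      us++ws↭ : us ++ ws ↭ zs ++ rest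
      us++ws↭ = drop-∷ (↭-trans (↭-sym (shift v us ws)) p)
      -- The remaining outside vertices are no deeper than `v`; those of `rest` are excluded by the
      -- present case.
      ¬below : All (λ a → ¬ Below (host v) (host a)) (us ++ ws)
      ¬below = All-resp-↭ (↭-sym us++ws↭)
        (All.++⁺ (All.map (λ z≤v b → <⇒≱ (Below⇒depth< b) z≤v) zs≤v) (All.¬Any⇒All¬ rest noneBelow))

    hamiltonian⇒extendable : Hamiltonian G → ¬ IsHamiltonianCycle G C → Extendable G C
    -- `H` is read from `c`, so that both cycles start at the root.
    hamiltonian⇒extendable (H , hamH) ¬hamC with rebase (hamH c) (Cycle.linked H)
    ... | ys , H↭ , l
      with unique-⊆⇒↭++ unique (λ {w} _ → ∈-resp-↭ H↭ (hamH w))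
    ...   | []     , p = contradiction (λ w → ∈-resp-↭ (↭-trans H↭ p) (hamH w)) ¬hamC
    ...   | z ∷ zs , p = extendable-within (length zs) {z ∷ zs} refl
      (unique-++⇒∉ (z ∷ zs) (Unique-resp-↭ (↭-trans H↭ p) (Cycle.unique H)))
      (drop-∷ (↭-trans p (shift c (z ∷ zs) rest)))
      (Linked.map adj⇒costellar l)

-- From distance at most four between leaves to common stars of their neighbours.

module _ {n : ℕ} {G : Graph n} (lp : IsLeafPower 4 G) where

  open IsLeafPower lp
  open Graph T using () renaming (Adj to Adjₜ; sym to symₜ)

  -- The degree equations carried by two equal leaves agree, as equality of naturals is
  -- proof-irrelevant.
  leaf-injective : ∀ {u v} → leaf u ≡ leaf v → u ≡ v
  leaf-injective {u} {v} eq = Bijection.injective leaves (Σ-≡ eq)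
    where
    Σ-≡ : ∀ {x y : Leaf T} → proj₁ x ≡ proj₁ y → x ≡ y
    Σ-≡ {x , p} {.x , q} refl = cong (x ,_) (≡-irrelevant p q)

  leaf-neighbour : ∀ v → ∃[ q ] Adjₜ (leaf v) q × (∀ {w} → Adjₜ (leaf v) w → w ≡ q)
  leaf-neighbour v = degree1⇒neighbour T (proj₂ (Bijection.to leaves v))

  host : Fin n → Fin size
  host v = proj₁ (leaf-neighbour v)

  leaf-host : ∀ v → Adjₜ (leaf v) (host v)
  leaf-host v = proj₁ (proj₂ (leaf-neighbour v))

  host-unique : ∀ {v w} → Adjₜ (leaf v) w → w ≡ host v
  host-unique {v} = proj₂ (proj₂ (leaf-neighbour v))

  -- The end edges of the walk are forced to lead to the hosts, leaving at most two edges between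
  -- these. The ends `x` and `y` are variables so that the walk can be matched on.
  walk⇒costellar : ∀ {u v x y d} → u ≢ v → x ≡ leaf u → y ≡ leaf v → d ≤ 4 → Walk T x y d →
                   CoStellar T (host u) (host v)
  walk⇒costellar u≢v refl eq   _ []       = contradiction (leaf-injective eq) u≢v
  -- With a single edge each leaf is the host of the other, so the hosts are adjacent.
  walk⇒costellar u≢v refl refl _ (e ∷ []) with host-unique e | host-unique (symₜ e)
  ... | leafv≡ | leafu≡ = _ , inj₁ refl , inj₂ (subst₂ Adjₜ leafu≡ leafv≡ e)
  walk⇒costellar u≢v refl refl _ (e ∷ f ∷ []) with host-unique e | host-unique (symₜ f)
  ... | refl | m≡ = _ , inj₁ refl , inj₁ (sym m≡)
  walk⇒costellar u≢v refl refl _ (e ∷ f ∷ g ∷ []) with host-unique e | host-unique (symₜ g)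
  ... | refl | refl = _ , inj₁ refl , inj₂ (symₜ f)
  walk⇒costellar u≢v refl refl _ (e ∷ f ∷ g ∷ h ∷ []) with host-unique e | host-unique (symₜ h)
  ... | refl | refl = _ , inj₂ f , inj₂ (symₜ g)
  walk⇒costellar u≢v refl refl (s≤s (s≤s (s≤s (s≤s ())))) (_ ∷ _ ∷ _ ∷ _ ∷ _ ∷ _)

  costellar⇒distance≤4 : ∀ {u v} → CoStellar T (host u) (host v) →
                         DistanceAtMost T 4 (leaf u) (leaf v)
  costellar⇒distance≤4 {u} {v} (m , su , sv) with to-centre su | from-centre sv
    where
    -- The first half prepends its edges to any walk from `m`, so applying it to the second half
    -- joins the two.
    to-centre : Star T m (host u) → ∃[ d ] d ≤ 2 × (∀ {w e} → Walk T m w e → Walk T (leaf u) w (d + e))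
    to-centre (inj₁ refl) = 1 , s≤s z≤n , λ p → leaf-host u ∷ p
    to-centre (inj₂ e)    = 2 , ≤-refl  , λ p → leaf-host u ∷ e ∷ p
    from-centre : Star T m (host v) → ∃[ d ] d ≤ 2 × Walk T m (leaf v) d
    from-centre (inj₁ refl) = 1 , s≤s z≤n , symₜ (leaf-host v) ∷ []
    from-centre (inj₂ e)    = 2 , ≤-refl  , symₜ e ∷ symₜ (leaf-host v) ∷ []
  ... | d , d≤2 , p | e , e≤2 , q with walk⇒distanceAtMost T (p q)
  ...   | f , dist , f≤ = f , dist , ≤-trans f≤ (+-mono-≤ d≤2 e≤2)

corollary1p4 : (n : ℕ) (G : Graph n) → IsLeafPower 4 G → Hamiltonian G → CycleExtendable G
corollary1p4 n G lp ham C ¬ham =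
  hamiltonian⇒extendable G T isTree (host lp) adj⇒costellar costellar⇒adj C ham ¬ham
  where
  open IsLeafPower lp
  adj⇒≢ : ∀ {u v} → Graph.Adj G u v → u ≢ v
  adj⇒≢ e refl = Graph.irrefl G refl e
  adj⇒costellar : ∀ {u v} → Graph.Adj G u v → CoStellar T (host lp u) (host lp v)
  adj⇒costellar {u} {v} e with adj⇒≢ e
  ... | u≢v with Equivalence.to (adj⇔close u v u≢v) e
  ...   | _ , (p , _) , d≤4 = walk⇒costellar lp u≢v refl refl d≤4 p
  costellar⇒adj : ∀ {u v} → u ≢ v → CoStellar T (host lp u) (host lp v) → Graph.Adj G u v
  costellar⇒adj {u} {v} u≢v s = Equivalence.from (adj⇔close u v u≢v) (costellar⇒distance≤4 lp s)
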